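{- Let $t\geq 6$. There exists $r_t$ such that $K_t$ is $r$-rainbow-uncommon for all $r\geq r_t$.
   Context: All graphs are simple. A copy of a graph $H$ in a graph $G$ is a subgraph of $G$ isomorphic to $H$. An $r$-coloring of a set $X$ is a surjective function $c:X\to\{1,\dots,r\}$. Under an edge-coloring of $G$, a subgraph $H$ is rainbow if all edges of $H$ receive pairwise distinct colors. For a graph $H$ with $e$ edges, let $M_{\mathrm{rb}}(H;n,r)$ be the maximum, over all $r$-colorings of $E(K_n)$, of the number of rainbow copies of $H$ in $K_n$; let $m_{\mathrm{rb}}(H;n,r)=M_{\mathrm{rb}}(H;n,r)/(\text{number of copies of } H \text{ in } K_n)$ and $m_{\mathrm{rb}}(H;r)=\lim_{n\to\infty} m_{\mathrm{rb}}(H;n,r)$ (this limit exists). $H$ is called $r$-rainbow-common if $m_{\mathrm{rb}}(H;r)=\binom{r}{e}e!/r^e$, and $r$-rainbow-uncommon otherwise. -}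

module Defs where

open import Data.Nat using (ℕ; zero; suc; _≤_; _*_; _^_)
open import Data.Nat.Combinatorics using (_C_)
open import Data.Nat.Base using (_!)
open import Data.Fin using (Fin; _<_)
open import Data.Fin.Properties using (all?; _<?_; _≟_)
open import Data.Fin.Subset using (Subset; _∈_; ∣_∣; inside; outside)
open import Data.Fin.Subset.Properties using (_∈?_)
open import Data.Vec using (_∷_; [])
open import Data.List using (List; []; _∷_; map; _++_; filter; length)
open import Data.Product using (Σ; ∃; _×_; _,_)
open import Data.Integer using (+_)
open import Data.Rational using (ℚ; 0ℚ; _/_; _-_; _>_) renaming (_<_ to _<ℚ_; ∣_∣ to abs)
open import Relation.Binary.PropositionalEquality using (_≡_; _≢_)
open import Relation.Nullary using (Dec; ¬_)
open import Relation.Nullary.Decidable using (_×-dec_; _→-dec_)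

-- An edge-colouring of K_n with colours Fin r: a symmetric function on
-- pairs of vertices; only the values at pairs i ≢ j are meaningful
-- (the diagonal is ignored everywhere below).
record EdgeColouring (n r : ℕ) : Set where
  field
    col : Fin n → Fin n → Fin r
    sym : ∀ i j → col i j ≡ col j i
open EdgeColouring public

-- An r-colouring must be surjective onto the colour set {1..r} (= Fin r).
Surjective : ∀ {n r} → EdgeColouring n r → Set
Surjective {n} {r} c = ∀ (k : Fin r) → ∃ λ (i : Fin n) → ∃ λ (j : Fin n) → (i ≢ j) × (col c i j ≡ k)

allSubsets : (n : ℕ) → List (Subset n)
allSubsets zero = [] ∷ []
allSubsets (suc n) = map (inside ∷_) (allSubsets n) ++ map (outside ∷_) (allSubsets n)

Rainbow : ∀ {n r} → EdgeColouring n r → Subset n → Set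
Rainbow {n} c S = ∀ (a b a' b' : Fin n) → a < b → a' < b' →
  a ∈ S → b ∈ S → a' ∈ S → b' ∈ S →
  col c a b ≡ col c a' b' → (a ≡ a') × (b ≡ b')

rainbow? : ∀ {n r} (c : EdgeColouring n r) (S : Subset n) → Dec (Rainbow c S)
rainbow? c S =
  all? λ a → all? λ b → all? λ a' → all? λ b' →
    (a <? b) →-dec ((a' <? b') →-dec ((a ∈? S) →-dec ((b ∈? S) →-dec
    ((a' ∈? S) →-dec ((b' ∈? S) →-dec
    ((col c a b Data.Fin.Properties.≟ col c a' b') →-dec ((a ≟ a') ×-dec (b ≟ b'))))))))

-- Copies of K_t in K_n are exactly the t-element vertex subsets.
IsRainbowKt : ∀ {n r} (t : ℕ) → EdgeColouring n r → Subset n → Set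
IsRainbowKt t c S = (∣ S ∣ ≡ t) × Rainbow c S

rainbowCopies : ∀ {n r} (t : ℕ) → EdgeColouring n r → ℕ
rainbowCopies {n} t c =
  length (filter (λ S → (∣ S ∣ Data.Nat.≟ t) ×-dec rainbow? c S) (allSubsets n))

IsMaxRainbow : (t n r M : ℕ) → Set
IsMaxRainbow t n r M =
  (∃ λ (c : EdgeColouring n r) → Surjective c × (rainbowCopies t c ≡ M))
  × (∀ (c : EdgeColouring n r) → Surjective c → rainbowCopies t c Data.Nat.≤ M)

-- m ÷ d as a rational; (arbitrary value 0 when d = 0, never used for large n).
_÷_ : ℕ → ℕ → ℚ
m ÷ zero = 0ℚ
m ÷ suc d = (+ m) / suc d

edges : ℕ → ℕ
edges t = t C 2

-- The "random colouring" value  binom(r,e) e! / r^e  with e = e(K_t).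
commonValue : (t r : ℕ) → ℚ
commonValue t r = ((r C edges t) * (edges t !)) ÷ (r ^ edges t)

ConvergesTo : (t r : ℕ) → ℚ → Set
ConvergesTo t r x = ∀ (ε : ℚ) → ε > 0ℚ → ∃ λ (N : ℕ) → ∀ (n : ℕ) → N Data.Nat.≤ n →
  ∀ (M : ℕ) → IsMaxRainbow t n r M → abs ((M ÷ (n C t)) - x) <ℚ ε

-- K_t is r-rainbow-common iff m_rb(K_t; r) = binom(r,e) e!/r^e.  Since the
-- limit m_rb(K_t; r) exists, this is the statement that the sequence
-- converges to that value; uncommon is the negation.
RainbowCommon : (t r : ℕ) → Set
RainbowCommon t r = ConvergesTo t r (commonValue t r)

RainbowUncommon : (t r : ℕ) → Set
RainbowUncommon t r = ¬ RainbowCommon t r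

{-# OPTIONS --safe #-}

-- Give the vertices balanced labels in ℤ/r and colour the edge uv with lab u + lab v.
-- When a rainbow clique with k distinctly labelled vertices is extended by v, the label of
-- v must avoid the at most k (1 + C(k,2)) solutions of  lab v + lab a = z , where z is
-- 2 lab a or one of the C(k,2) colours already present. Hence the rainbow density of K_t
-- is at least  ∏_{k<t} (1 − k(1 + C(k,2))/r) = 1 − F/r + O(1/r²) , against
-- ∏_{i<e} (1 − i/r) = 1 − C(e,2)/r + O(1/r²)  with e = C(t,2) for the random value.
-- Collisions between adjacent edges cluster at coinciding labels, which is why
-- F < C(e,2); with this count of forbidden labels that holds exactly from t = 6 on.
module Submission where

open import Defs hiding (sym)
import Data.Nat.Properties
open import Algebra.Properties.CommutativeMonoid.Sum Data.Nat.Properties.+-0-commutativeMonoid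
  using (sum; ∑-distrib-+)
open import Data.Bool using (true; false; if_then_else_)
open import Data.Fin as Fin using (Fin; zero; suc; combine; remainder; toℕ; fromℕ<; _↑ˡ_; _↑ʳ_)
import Data.Fin.Properties as Finₚ
open import Data.Fin.Subset using (Subset; inside; outside; _∈_; _∉_; ∣_∣)
open import Data.Fin.Subset.Properties using (_∈?_)
import Data.Integer as ℤ
import Data.Integer.Properties as ℤₚ
open import Data.List using (List; []; _∷_; _++_; map; length; filter; cartesianProduct)
open import Data.List.Membership.Propositional using (lose) renaming (_∈_ to _∈ˡ_)
open import Data.List.Membership.Propositional.Properties
  using (∈-map⁺; ∈-++⁺ˡ; ∈-++⁺ʳ; ∈-cartesianProduct⁺)
open import Data.List.Properties using (length-map; length-++; length-filter; filter-++)
open import Data.List.Relation.Unary.Any using (Any; here; there; any?)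
open import Data.Nat
open import Data.Nat.Combinatorics using (_C_; nC1≡n; nCk+nC[k+1]≡[n+1]C[k+1])
open import Data.Nat.DivMod using (_%_; _mod_; m%n<n; m<n⇒m%n≡m; m%n%n≡m%n; [m+kn]%n≡m%n; %-distribˡ-+)
open import Data.Nat.Properties
open import Data.Nat.Tactic.RingSolver using (solve-∀)
open import Data.Product using (_×_; _,_; proj₁; proj₂; ∃; uncurry)
open import Data.Rational as ℚ using (0ℚ)
import Data.Rational.Properties as ℚₚ
open import Data.Rational.Unnormalised as ℚᵘ using (mkℚᵘ)
import Data.Rational.Unnormalised.Properties as ℚᵘₚ
open import Data.Sum using (_⊎_; inj₁; inj₂)
open import Data.Vec using ([]; _∷_; _[_]≔_; here; there)
open import Function using (_∘_)
open import Relation.Binary.PropositionalEquality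
open import Relation.Nullary using (Dec; yes; no; does; ¬_; ¬?; contradiction)
open import Relation.Nullary.Decidable using (_×-dec_; _→-dec_; dec-true; dec-false)

-- Binomial coefficients and the comparison of the two products

∑< : ℕ → (ℕ → ℕ) → ℕ
∑< zero    f = 0
∑< (suc k) f = ∑< k f + f k

∏< : ℕ → (ℕ → ℕ) → ℕ
∏< zero    f = 1
∏< (suc k) f = ∏< k f * f k

-- The number of edges of a clique on k vertices, in a form that unfolds by one summand; iterated,
-- `triangle (triangle t)` is C(e,2) for e = C(t,2).
triangle : ℕ → ℕ
triangle k = ∑< k (λ i → i)

triangle-+ : ∀ a b → triangle (a + b) ≡ triangle a + triangle b + a * b
triangle-+ a zero    rewrite +-identityʳ a | *-zeroʳ a = identity (triangle a)
  where identity : ∀ x → x ≡ x + 0 + 0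
        identity = solve-∀
triangle-+ a (suc b) rewrite +-suc a b | triangle-+ a b = identity (triangle a) (triangle b) a b
  where identity : ∀ x y a b → x + y + a * b + (a + b) ≡ x + (y + b) + a * suc b
        identity = solve-∀

triangle≡C2 : ∀ n → triangle n ≡ n C 2
triangle≡C2 zero    = refl
triangle≡C2 (suc n) = begin
  triangle n + n     ≡⟨ cong₂ _+_ (triangle≡C2 n) (sym (nC1≡n n)) ⟩
  n C 2 + n C 1      ≡⟨ +-comm (n C 2) (n C 1) ⟩
  n C 1 + n C 2      ≡⟨ nCk+nC[k+1]≡[n+1]C[k+1] n 1 ⟩
  suc n C 2          ∎
  where open ≡-Reasoning

-- Absorption with the subtraction moved to the left, so that it holds for every k and follows from
-- Pascal's rule by ring identities.
[1+k]*nC[1+k]+k*nCk≡n*nCk : ∀ n k → suc k * (n C suc k) + k * (n C k) ≡ n * (n C k)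
[1+k]*nC[1+k]+k*nCk≡n*nCk zero zero = refl
[1+k]*nC[1+k]+k*nCk≡n*nCk zero (suc k)
  rewrite *-zeroʳ k = refl
[1+k]*nC[1+k]+k*nCk≡n*nCk (suc n) zero rewrite nC1≡n (suc n) = identity n
  where identity : ∀ n → 1 * suc n + 0 ≡ suc n * 1
        identity = solve-∀
[1+k]*nC[1+k]+k*nCk≡n*nCk (suc n) (suc k)
  rewrite sym (nCk+nC[k+1]≡[n+1]C[k+1] n k) | sym (nCk+nC[k+1]≡[n+1]C[k+1] n (suc k)) = begin
  suc (suc k) * (y + z) + suc k * (x + y)                     ≡⟨ regroup k x y z ⟩
  (suc (suc k) * z + suc k * y) + y + (suc k * y + k * x) + x ≡⟨ cong₂ (λ u v → u + y + v + x)
                                                                  ([1+k]*nC[1+k]+k*nCk≡n*nCk n (suc k))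
                                                                  ([1+k]*nC[1+k]+k*nCk≡n*nCk n k) ⟩
  n * y + y + n * x + x                                       ≡⟨ collect n x y ⟩
  suc n * (x + y)                                             ∎
  where
  open ≡-Reasoning
  x = n C k
  y = n C suc k
  z = n C suc (suc k)
  regroup : ∀ k x y z → suc (suc k) * (y + z) + suc k * (x + y)
          ≡ (suc (suc k) * z + suc k * y) + y + (suc k * y + k * x) + x
  regroup = solve-∀
  collect : ∀ n x y → n * y + y + n * x + x ≡ suc n * (x + y)
  collect = solve-∀

[1+k]*nC[1+k]≤n*nCk : ∀ n k → suc k * (n C suc k) ≤ n * (n C k)
[1+k]*nC[1+k]≤n*nCk n k = subst (suc k * (n C suc k) ≤_) ([1+k]*nC[1+k]+k*nCk≡n*nCk n k) (m≤m+n _ _)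

[1+k]*nC[1+k]≡[n∸k]*nCk : ∀ n k → suc k * (n C suc k) ≡ (n ∸ k) * (n C k)
[1+k]*nC[1+k]≡[n∸k]*nCk n k = begin
  suc k * (n C suc k)                                 ≡⟨ m+n∸n≡m _ (k * (n C k)) ⟨
  suc k * (n C suc k) + k * (n C k) ∸ k * (n C k)     ≡⟨ cong (_∸ k * (n C k)) ([1+k]*nC[1+k]+k*nCk≡n*nCk n k) ⟩
  n * (n C k) ∸ k * (n C k)                           ≡⟨ *-distribʳ-∸ (n C k) n k ⟨
  (n ∸ k) * (n C k)                                   ∎
  where open ≡-Reasoning

-- The falling factorial. At k = e it brings the numerator of `commonValue` into product form, where
-- it can be compared with the density of the construction.
nCk*k!≡∏ : ∀ n k → (n C k) * k ! ≡ ∏< k (n ∸_)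
nCk*k!≡∏ n zero    = refl
nCk*k!≡∏ n (suc k) = begin
  (n C suc k) * (suc k * k !)    ≡⟨ swap (n C suc k) (suc k) (k !) ⟩
  suc k * (n C suc k) * k !      ≡⟨ cong (_* k !) ([1+k]*nC[1+k]≡[n∸k]*nCk n k) ⟩
  (n ∸ k) * (n C k) * k !        ≡⟨ rotate (n ∸ k) (n C k) (k !) ⟩
  (n C k) * k ! * (n ∸ k)        ≡⟨ cong (_* (n ∸ k)) (nCk*k!≡∏ n k) ⟩
  ∏< k (n ∸_) * (n ∸ k)          ∎
  where
  open ≡-Reasoning
  swap : ∀ a b c → a * (b * c) ≡ b * a * c
  swap = solve-∀
  rotate : ∀ a b c → a * b * c ≡ b * c * a
  rotate = solve-∀

nCk>0 : ∀ {n k} → k ≤ n → 0 < n C k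
nCk>0 {n} {zero} _ = s≤s z≤n
nCk>0 {suc n} {suc k} (s≤s k≤n) =
  subst (0 <_) (nCk+nC[k+1]≡[n+1]C[k+1] n k) (<-≤-trans (nCk>0 k≤n) (m≤m+n _ _))

-- The two estimates below are  ∏ (1 − aᵢ/r) ≥ 1 − ∑ aᵢ/r  and
-- ∏ (1 − i/r) · (1 + ∑ i/r) ≤ 1  with denominators cleared.
∏-lower : ∀ r (a : ℕ → ℕ) k → r ^ k * (r ∸ ∑< k a) ≤ ∏< k (λ i → r ∸ a i) * r
∏-lower r a zero    = ≤-refl
∏-lower r a (suc k) = begin
  r * r ^ k * (r ∸ (∑< k a + a k))             ≡⟨ reorder r (r ^ k) _ ⟩
  r ^ k * (r * (r ∸ (∑< k a + a k)))           ≤⟨ *-monoʳ-≤ (r ^ k) (step (∑< k a) (a k)) ⟩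
  r ^ k * ((r ∸ ∑< k a) * (r ∸ a k))           ≡⟨ *-assoc (r ^ k) _ _ ⟨
  r ^ k * (r ∸ ∑< k a) * (r ∸ a k)             ≤⟨ *-monoˡ-≤ (r ∸ a k) (∏-lower r a k) ⟩
  ∏< k (λ i → r ∸ a i) * r * (r ∸ a k)         ≡⟨ reorder′ (∏< k (λ i → r ∸ a i)) r _ ⟩
  ∏< k (λ i → r ∸ a i) * (r ∸ a k) * r         ∎
  where
  open ≤-Reasoning
  reorder : ∀ x y z → x * y * z ≡ y * (x * z)
  reorder = solve-∀
  reorder′ : ∀ x y z → x * y * z ≡ x * z * y
  reorder′ = solve-∀
  expand : ∀ b c d → (b + c + d) * d + b * c ≡ (c + d) * (b + d)
  expand = solve-∀
  step : ∀ b c → r * (r ∸ (b + c)) ≤ (r ∸ b) * (r ∸ c)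
  step b c with ≤-total (b + c) r
  ... | inj₂ r≤b+c rewrite m≤n⇒m∸n≡0 r≤b+c | *-zeroʳ r = z≤n
  ... | inj₁ b+c≤r with m≤n⇒∃[o]m+o≡n b+c≤r
  -- With r = b + c + d the two sides differ by exactly `b * c`.
  ...   | d , refl = begin
    (b + c + d) * (b + c + d ∸ (b + c))     ≡⟨ cong ((b + c + d) *_) (m+n∸m≡n (b + c) d) ⟩
    (b + c + d) * d                         ≤⟨ m≤m+n _ (b * c) ⟩
    (b + c + d) * d + b * c                 ≡⟨ expand b c d ⟩
    (c + d) * (b + d)                       ≡⟨ cong₂ _*_ (m+n∸m≡n b (c + d)) (m+n∸m≡n c (b + d)) ⟨
    (b + (c + d) ∸ b) * (c + (b + d) ∸ c)   ≡⟨ cong₂ (λ u v → (u ∸ b) * (v ∸ c)) (assocˡ b c d) (assocʳ b c d) ⟩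
    (b + c + d ∸ b) * (b + c + d ∸ c)       ∎
    where
    assocˡ : ∀ b c d → b + (c + d) ≡ b + c + d
    assocˡ = solve-∀
    assocʳ : ∀ b c d → c + (b + d) ≡ b + c + d
    assocʳ = solve-∀

∏-upper : ∀ r k → ∏< k (r ∸_) * (r + triangle k) ≤ r ^ k * r
∏-upper r zero    = ≤-reflexive (cong (1 *_) (+-identityʳ r))
∏-upper r (suc k) = begin
  ∏< k (r ∸_) * (r ∸ k) * (r + (triangle k + k))     ≡⟨ *-assoc (∏< k (r ∸_)) _ _ ⟩
  ∏< k (r ∸_) * ((r ∸ k) * (r + (triangle k + k)))   ≤⟨ *-monoʳ-≤ (∏< k (r ∸_)) (step (triangle k)) ⟩
  ∏< k (r ∸_) * ((r + triangle k) * r)               ≡⟨ *-assoc (∏< k (r ∸_)) _ _ ⟨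
  ∏< k (r ∸_) * (r + triangle k) * r                 ≤⟨ *-monoˡ-≤ r (∏-upper r k) ⟩
  r ^ k * r * r                                      ≡⟨ cong (_* r) (*-comm (r ^ k) r) ⟩
  r ^ suc k * r                                      ∎
  where
  open ≤-Reasoning
  expand : ∀ k d s → d * (k + d + (s + k)) + k * (s + k) ≡ (k + d + s) * (k + d)
  expand = solve-∀
  step : ∀ s → (r ∸ k) * (r + (s + k)) ≤ (r + s) * r
  step s with ≤-total k r
  ... | inj₂ r≤k rewrite m≤n⇒m∸n≡0 r≤k = z≤n
  ... | inj₁ k≤r with m≤n⇒∃[o]m+o≡n k≤r
  -- With r = k + d the two sides differ by exactly `k * (s + k)`.
  ...   | d , refl rewrite m+n∸m≡n k d = ≤-trans (m≤m+n _ _) (≤-reflexive (expand k d s))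

-- The number of conditions  lab v ⊕ lab a ≡ z  forbidding v as an extension of a
-- rainbow k-set: a is one of k vertices, z the colour of an edge or lab a ⊕ lab a.
conflicts : ℕ → ℕ
conflicts k = k * suc (triangle k)

n≤triangle : ∀ j → 3 + j ≤ triangle (3 + j)
n≤triangle zero    = ≤-refl
n≤triangle (suc j) = begin
  suc (3 + j)                     ≤⟨ s≤s (n≤triangle j) ⟩
  suc (triangle (3 + j))          ≤⟨ m≤m+n _ (2 + j) ⟩
  suc (triangle (3 + j)) + (2 + j) ≡⟨ +-suc (triangle (3 + j)) (2 + j) ⟨
  triangle (3 + j) + (3 + j)      ∎
  where open ≤-Reasoning

-- From t to t + 1 the left side grows by t + t * C(t,2) and the right side by C(t,2) + C(t,2) * t,
-- so t ≤ C(t,2) preserves the inequality.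
∑conflicts<∑i : ∀ {t} → 6 ≤ t → ∑< t conflicts < triangle (triangle t)
∑conflicts<∑i 6≤t with m≤n⇒∃[o]m+o≡n 6≤t
... | j , refl = from-six j
  where
  open ≤-Reasoning
  regroup : ∀ x t y → x + t * suc y ≡ x + t + y * t
  regroup = solve-∀
  step : ∀ t → t ≤ triangle t → ∑< t conflicts < triangle (triangle t) →
         ∑< (suc t) conflicts < triangle (triangle (suc t))
  step t t≤△ ih = begin-strict
    ∑< t conflicts + t * suc (triangle t)                    <⟨ +-monoˡ-< _ ih ⟩
    triangle (triangle t) + t * suc (triangle t)             ≡⟨ regroup (triangle (triangle t)) t (triangle t) ⟩
    triangle (triangle t) + t + triangle t * t               ≤⟨ +-monoˡ-≤ (triangle t * t) (+-monoʳ-≤ (triangle (triangle t)) t≤△) ⟩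
    triangle (triangle t) + triangle t + triangle t * t      ≡⟨ triangle-+ (triangle t) t ⟨
    triangle (triangle t + t)                                ∎
  from-six : ∀ j → ∑< (6 + j) conflicts < triangle (triangle (6 + j))
  -- The two sums are 100 and 105 here; at t = 5 both equal 45.
  from-six zero    = m≤m+n 101 4
  from-six (suc j) = step (6 + j) (n≤triangle (3 + j)) (from-six j)

-- The right side is r² + (E - F) r - E F, and E - F is at least 1, so r > E F suffices. This is the
-- source of the threshold for r.
r*r<[r∸F]*[r+E] : ∀ {E F} r → F < E → E * F < r → r * r < (r ∸ F) * (r + E)
r*r<[r∸F]*[r+E] {E} {F} r F<E EF<r with m≤n⇒∃[o]m+o≡n F<E | m≤n⇒∃[o]m+o≡n F≤r
  where
  F≤r : F ≤ r
  F≤r = ≤-trans (m≤n*m F E {{>-nonZero (≤-<-trans z≤n F<E)}}) (<⇒≤ EF<r)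
... | g , refl | d , refl = begin-strict
  (F + d) * (F + d)                            ≡⟨ expand₁ F d ⟩
  F * F + (F * d + (F * d + d * d))            <⟨ +-monoˡ-< _ F*F<d ⟩
  d + (F * d + (F * d + d * d))                ≤⟨ m≤m+n _ (d * g) ⟩
  d + (F * d + (F * d + d * d)) + d * g        ≡⟨ expand₂ F d g ⟩
  d * (F + d + (suc F + g))                    ≡⟨ cong (_* (F + d + (suc F + g))) (m+n∸m≡n F d) ⟨
  (F + d ∸ F) * (F + d + (suc F + g))          ∎
  where
  open ≤-Reasoning
  expand₁ : ∀ F d → (F + d) * (F + d) ≡ F * F + (F * d + (F * d + d * d))
  expand₁ = solve-∀
  expand₂ : ∀ F d g → d + (F * d + (F * d + d * d)) + d * g ≡ d * (F + d + (suc F + g))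
  expand₂ = solve-∀
  F*F<d : F * F < d
  -- Cancel F in F + F * F = (F + 1) * F ≤ E * F < r = F + d.
  F*F<d = +-cancelˡ-< F _ _ (≤-<-trans (*-monoˡ-≤ F (m≤m+n (suc F) g)) EF<r)

-- This is Q / r^e < P / r^k with denominators cleared. The upper bound on Q and the lower bound on
-- P are multiplied together, and the common factor `r * (r + E)` is cancelled at the end.
∏-gap : ∀ r e k (a : ℕ → ℕ) → ∑< k a < triangle e → triangle e * ∑< k a < r →
        ∏< e (r ∸_) * r ^ k < ∏< k (λ i → r ∸ a i) * r ^ e
∏-gap r e k a F<E EF<r = *-cancelʳ-< _ _ _ (begin-strict
  Q * r ^ k * (r * (r + E))            ≡⟨ regroup₁ Q (r ^ k) r (r + E) ⟩
  Q * (r + E) * (r ^ k * r)            ≤⟨ *-monoˡ-≤ (r ^ k * r) (∏-upper r e) ⟩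
  r ^ e * r * (r ^ k * r)              ≡⟨ regroup₂ (r ^ e) (r ^ k) r ⟩
  r ^ e * r ^ k * (r * r)              <⟨ *-monoʳ-< (r ^ e * r ^ k) (r*r<[r∸F]*[r+E] r F<E EF<r) ⟩
  r ^ e * r ^ k * ((r ∸ F) * (r + E))  ≡⟨ regroup₃ (r ^ e) (r ^ k) (r ∸ F) (r + E) ⟩
  r ^ k * (r ∸ F) * (r ^ e * (r + E))  ≤⟨ *-monoˡ-≤ (r ^ e * (r + E)) (∏-lower r a k) ⟩
  P * r * (r ^ e * (r + E))            ≡⟨ regroup₄ P r (r ^ e) (r + E) ⟩
  P * r ^ e * (r * (r + E))            ∎)
  where
  open ≤-Reasoning
  E = triangle e
  F = ∑< k a
  Q = ∏< e (r ∸_)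
  P = ∏< k (λ i → r ∸ a i)
  instance
    r≢0 : NonZero r
    r≢0 = >-nonZero (≤-<-trans z≤n EF<r)
    r^e≢0 : NonZero (r ^ e)
    r^e≢0 = m^n≢0 r e
    r^k≢0 : NonZero (r ^ k)
    r^k≢0 = m^n≢0 r k
    r^e*r^k≢0 : NonZero (r ^ e * r ^ k)
    r^e*r^k≢0 = m*n≢0 (r ^ e) (r ^ k)
  regroup₁ : ∀ q x r y → q * x * (r * y) ≡ q * y * (x * r)
  regroup₁ = solve-∀
  regroup₂ : ∀ x y r → x * r * (y * r) ≡ x * y * (r * r)
  regroup₂ = solve-∀
  regroup₃ : ∀ x y u v → x * y * (u * v) ≡ y * u * (x * v)
  regroup₃ = solve-∀
  regroup₄ : ∀ p r x v → p * r * (x * v) ≡ p * x * (r * v)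
  regroup₄ = solve-∀

-- Sums over vertices and over vertex subsets

private variable
  n : ℕ
  P Q : Set

-- The Iverson bracket, which turns counting into summation.
⟦_⟧ : Dec P → ℕ
⟦ d ⟧ = if does d then 1 else 0

⟦⟧-true : (p? : Dec P) → P → ⟦ p? ⟧ ≡ 1
⟦⟧-true p? p rewrite dec-true p? p = refl

⟦⟧-false : (p? : Dec P) → ¬ P → ⟦ p? ⟧ ≡ 0
⟦⟧-false p? ¬p rewrite dec-false p? ¬p = refl

⟦⟧-mono : (p? : Dec P) (q? : Dec Q) → (P → Q) → ⟦ p? ⟧ ≤ ⟦ q? ⟧
⟦⟧-mono (no _)  q? f = z≤n
⟦⟧-mono (yes p) q? f = ≤-reflexive (sym (⟦⟧-true q? (f p)))

sum-mono : {f g : Fin n → ℕ} → (∀ i → f i ≤ g i) → sum f ≤ sum g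
sum-mono {zero}  f≤g = z≤n
sum-mono {suc n} f≤g = +-mono-≤ (f≤g zero) (sum-mono (f≤g ∘ suc))

sum-const : ∀ n x → sum {n} (λ _ → x) ≡ n * x
sum-const zero    x = refl
sum-const (suc n) x = cong (x +_) (sum-const n x)

sum-↑ : ∀ m {n} (f : Fin (m + n) → ℕ) → sum f ≡ sum (λ i → f (i ↑ˡ n)) + sum (λ j → f (m ↑ʳ j))
sum-↑ zero    f = refl
sum-↑ (suc m) f = trans (cong (f zero +_) (sum-↑ m (f ∘ suc))) (sym (+-assoc (f zero) _ _))

sum-combine : ∀ m {r} (f : Fin (m * r) → ℕ) → sum f ≡ sum (λ i → sum (λ j → f (combine {m} i j)))
sum-combine zero        f = refl
sum-combine (suc m) {r} f = trans (sum-↑ r f) (cong (sum (λ j → f (j ↑ˡ m * r)) +_) (sum-combine m _))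

sum-⟦⟧≤1 : {P : Fin n → Set} (P? : ∀ i → Dec (P i)) → (∀ {i j} → P i → P j → i ≡ j) →
           sum (λ i → ⟦ P? i ⟧) ≤ 1
sum-⟦⟧≤1 {zero}  P? uniq = z≤n
sum-⟦⟧≤1 {suc n} {P} P? uniq with P? zero
... | no _  = sum-⟦⟧≤1 (P? ∘ suc) (λ p q → Finₚ.suc-injective (uniq p q))
... | yes p = s≤s (begin
  sum (λ i → ⟦ P? (suc i) ⟧)  ≤⟨ sum-mono (λ i → ≤-reflexive (⟦⟧-false (P? (suc i)) (λ q → Finₚ.0≢1+n (uniq p q)))) ⟩
  sum {n} (λ _ → 0)           ≡⟨ sum-const n 0 ⟩
  n * 0                       ≡⟨ *-zeroʳ n ⟩
  0                           ∎)
  where open ≤-Reasoning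

-- The recursion is that of `allSubsets`, so that lengths of filtered lists become sums over
-- vectors.
∑⊆ : ∀ n → (Subset n → ℕ) → ℕ
∑⊆ zero    f = f []
∑⊆ (suc n) f = ∑⊆ n (f ∘ (inside ∷_)) + ∑⊆ n (f ∘ (outside ∷_))

∑⊆-mono : ∀ n {f g : Subset n → ℕ} → (∀ S → f S ≤ g S) → ∑⊆ n f ≤ ∑⊆ n g
∑⊆-mono zero    f≤g = f≤g []
∑⊆-mono (suc n) f≤g = +-mono-≤ (∑⊆-mono n (f≤g ∘ (inside ∷_))) (∑⊆-mono n (f≤g ∘ (outside ∷_)))

∑⊆-+ : ∀ n (f g : Subset n → ℕ) → ∑⊆ n (λ S → f S + g S) ≡ ∑⊆ n f + ∑⊆ n g
∑⊆-+ zero    f g = refl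
∑⊆-+ (suc n) f g
  rewrite ∑⊆-+ n (f ∘ (inside ∷_)) (g ∘ (inside ∷_)) | ∑⊆-+ n (f ∘ (outside ∷_)) (g ∘ (outside ∷_))
  = interchange (∑⊆ n (f ∘ (inside ∷_))) _ _ _
  where
  interchange : ∀ a b c d → a + b + (c + d) ≡ a + c + (b + d)
  interchange = solve-∀

∑⊆-*ˡ : ∀ n x (f : Subset n → ℕ) → ∑⊆ n (λ S → x * f S) ≡ x * ∑⊆ n f
∑⊆-*ˡ zero    x f = refl
∑⊆-*ˡ (suc n) x f
  rewrite ∑⊆-*ˡ n x (f ∘ (inside ∷_)) | ∑⊆-*ˡ n x (f ∘ (outside ∷_))
  = sym (*-distribˡ-+ x _ _)

length-filter-map : ∀ {A B : Set} {P : B → Set} (P? : ∀ b → Dec (P b)) (g : A → B) xs →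
                    length (filter P? (map g xs)) ≡ length (filter (P? ∘ g) xs)
length-filter-map P? g [] = refl
length-filter-map P? g (x ∷ xs) with does (P? (g x))
... | true  = cong suc (length-filter-map P? g xs)
... | false = length-filter-map P? g xs

length-filter-allSubsets : ∀ n {P : Subset n → Set} (P? : ∀ S → Dec (P S)) →
                           length (filter P? (allSubsets n)) ≡ ∑⊆ n (λ S → ⟦ P? S ⟧)
length-filter-allSubsets zero P? with does (P? [])
... | true  = refl
... | false = refl
length-filter-allSubsets (suc n) P? = begin
  length (filter P? (ins ++ outs))                         ≡⟨ cong length (filter-++ P? ins outs) ⟩
  length (filter P? ins ++ filter P? outs)                 ≡⟨ length-++ (filter P? ins) ⟩
  length (filter P? ins) + length (filter P? outs)         ≡⟨ cong₂ _+_ (half inside) (half outside) ⟩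
  ∑⊆ (suc n) (λ S → ⟦ P? S ⟧)                              ∎
  where
  open ≡-Reasoning
  ins outs : List (Subset (suc n))
  ins  = map (inside ∷_) (allSubsets n)
  outs = map (outside ∷_) (allSubsets n)
  half : ∀ b → length (filter P? (map (b ∷_) (allSubsets n))) ≡ ∑⊆ n (λ S → ⟦ P? (b ∷ S) ⟧)
  half b = trans (length-filter-map P? (b ∷_) (allSubsets n)) (length-filter-allSubsets n (P? ∘ (b ∷_)))

-- Double counting of the pairs (S , T) where T arises from S by adding one vertex.
∑-insert : ∀ n (f : Subset n → ℕ) →
  ∑⊆ n (λ S → sum (λ v → ⟦ ¬? (v ∈? S) ⟧ * f (S [ v ]≔ inside))) ≡ ∑⊆ n (λ S → ∣ S ∣ * f S)
∑-insert zero    f = refl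
∑-insert (suc n) f = begin
  -- Split on membership of vertex `zero`. If S contains it, only later vertices can be added; if
  -- not, adding `zero` contributes `fⁱ S`, with `+ 0` left over from the factor 1. That
  -- contribution supplies the extra unit of size of the sets containing `zero`.
  ∑⊆ n (λ S → sum (λ v → ⟦ ¬? (v ∈? S) ⟧ * fⁱ (S [ v ]≔ inside)))
    + ∑⊆ n (λ S → fⁱ S + 0 + sum (λ v → ⟦ ¬? (v ∈? S) ⟧ * fᵒ (S [ v ]≔ inside)))
      ≡⟨ cong₂ _+_ (∑-insert n fⁱ) (∑⊆-+ n (λ S → fⁱ S + 0) _) ⟩
  ∑⊆ n (λ S → ∣ S ∣ * fⁱ S) + (∑⊆ n (λ S → fⁱ S + 0) + ∑⊆ n (λ S → sum (λ v → ⟦ ¬? (v ∈? S) ⟧ * fᵒ (S [ v ]≔ inside))))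
      ≡⟨ cong (λ x → ∑⊆ n (λ S → ∣ S ∣ * fⁱ S) + (∑⊆ n (λ S → fⁱ S + 0) + x)) (∑-insert n fᵒ) ⟩
  ∑⊆ n (λ S → ∣ S ∣ * fⁱ S) + (∑⊆ n (λ S → fⁱ S + 0) + ∑⊆ n (λ S → ∣ S ∣ * fᵒ S))
      ≡⟨ regroup (∑⊆ n (λ S → ∣ S ∣ * fⁱ S)) (∑⊆ n (λ S → fⁱ S + 0)) (∑⊆ n (λ S → ∣ S ∣ * fᵒ S)) ⟩
  ∑⊆ n (λ S → fⁱ S + 0) + ∑⊆ n (λ S → ∣ S ∣ * fⁱ S) + ∑⊆ n (λ S → ∣ S ∣ * fᵒ S)
      ≡⟨ cong (_+ ∑⊆ n (λ S → ∣ S ∣ * fᵒ S)) (∑⊆-+ n (λ S → fⁱ S + 0) (λ S → ∣ S ∣ * fⁱ S)) ⟨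
  ∑⊆ n (λ S → fⁱ S + 0 + ∣ S ∣ * fⁱ S) + ∑⊆ n (λ S → ∣ S ∣ * fᵒ S)
      ≡⟨ cong (_+ ∑⊆ n (λ S → ∣ S ∣ * fᵒ S)) (∑⊆-cong n (λ S → cong (_+ ∣ S ∣ * fⁱ S) (+-identityʳ (fⁱ S)))) ⟩
  ∑⊆ n (λ S → fⁱ S + ∣ S ∣ * fⁱ S) + ∑⊆ n (λ S → ∣ S ∣ * fᵒ S)                           ∎
  where
  open ≡-Reasoning
  fⁱ fᵒ : Subset n → ℕ
  fⁱ = f ∘ (inside ∷_)
  fᵒ = f ∘ (outside ∷_)
  regroup : ∀ a b c → a + (b + c) ≡ b + a + c
  regroup = solve-∀
  ∑⊆-cong : ∀ n {f g : Subset n → ℕ} → (∀ S → f S ≡ g S) → ∑⊆ n f ≡ ∑⊆ n g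
  ∑⊆-cong n f≡g = ≤-antisym (∑⊆-mono n (≤-reflexive ∘ f≡g)) (∑⊆-mono n (≤-reflexive ∘ sym ∘ f≡g))

elements : Subset n → List (Fin n)
elements []            = []
elements (inside ∷ S)  = zero ∷ map suc (elements S)
elements (outside ∷ S) = map suc (elements S)

length-elements : (S : Subset n) → length (elements S) ≡ ∣ S ∣
length-elements []            = refl
length-elements (inside ∷ S)  = cong suc (trans (length-map suc (elements S)) (length-elements S))
length-elements (outside ∷ S) = trans (length-map suc (elements S)) (length-elements S)

∈-elements : ∀ {S : Subset n} {v} → v ∈ S → v ∈ˡ elements S
∈-elements {S = inside ∷ S}  here        = here refl
∈-elements {S = inside ∷ S}  (there v∈S) = there (∈-map⁺ suc (∈-elements v∈S))
∈-elements {S = outside ∷ S} (there v∈S) = ∈-map⁺ suc (∈-elements v∈S)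

∈-insert⁻ : ∀ (S : Subset n) v {w} → w ∈ S [ v ]≔ inside → w ≡ v ⊎ w ∈ S
∈-insert⁻ (x ∷ S) zero    here      = inj₁ refl
∈-insert⁻ (x ∷ S) zero    (there p) = inj₂ (there p)
∈-insert⁻ (x ∷ S) (suc v) here      = inj₂ here
∈-insert⁻ (x ∷ S) (suc v) (there p) with ∈-insert⁻ S v p
... | inj₁ refl = inj₁ refl
... | inj₂ q    = inj₂ (there q)

∣insert∣ : ∀ (S : Subset n) v → v ∉ S → ∣ S [ v ]≔ inside ∣ ≡ suc ∣ S ∣
∣insert∣ (inside  ∷ S) zero    v∉S = contradiction here v∉S
∣insert∣ (outside ∷ S) zero    v∉S = refl
∣insert∣ (inside  ∷ S) (suc v) v∉S = cong suc (∣insert∣ S v (v∉S ∘ there))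
∣insert∣ (outside ∷ S) (suc v) v∉S = ∣insert∣ S v (v∉S ∘ there)

module _ {A B : Set} (f : A → A → B) where

  -- One value for each unordered pair. Listing ordered pairs would double the number of edge
  -- colours to avoid, and `∑conflicts<∑i` would fail.
  pairs : List A → List B
  pairs []       = []
  pairs (x ∷ xs) = pairs xs ++ map (f x) xs

  length-pairs : ∀ xs → length (pairs xs) ≡ triangle (length xs)
  length-pairs []       = refl
  length-pairs (x ∷ xs) = trans (length-++ (pairs xs)) (cong₂ _+_ (length-pairs xs) (length-map (f x) xs))

  ∈-pairs : (∀ x y → f x y ≡ f y x) → ∀ {x y xs} → x ∈ˡ xs → y ∈ˡ xs → x ≢ y → f x y ∈ˡ pairs xs
  ∈-pairs f-comm (here refl) (here refl) x≢y = contradiction refl x≢y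
  ∈-pairs f-comm {xs = _ ∷ xs} (here refl) (there q)   x≢y = ∈-++⁺ʳ (pairs xs) (∈-map⁺ _ q)
  ∈-pairs f-comm {x} {y} {_ ∷ xs} (there p)   (here refl) x≢y
    rewrite f-comm x y = ∈-++⁺ʳ (pairs xs) (∈-map⁺ _ p)
  ∈-pairs f-comm (there p)   (there q)   x≢y = ∈-++⁺ˡ (∈-pairs f-comm p q x≢y)

-- Rainbow cliques under a sum colouring

length-cartesianProduct : ∀ {A B : Set} (xs : List A) (ys : List B) →
                          length (cartesianProduct xs ys) ≡ length xs * length ys
length-cartesianProduct []       ys = refl
length-cartesianProduct (x ∷ xs) ys =
  trans (length-++ (map (x ,_) ys)) (cong₂ _+_ (length-map (x ,_) ys) (length-cartesianProduct xs ys))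

-- The counting rests on commutativity, cancellation and `fibre`, which says that the labelling is
-- balanced: a condition on `lab v ⊕ y` excludes at most m vertices.
module SumColouring
  {n r m : ℕ} (lab : Fin n → Fin r)
  (_⊕_ : Fin r → Fin r → Fin r)
  (⊕-comm : ∀ x y → x ⊕ y ≡ y ⊕ x)
  (⊕-cancelʳ : ∀ {x x′} y → x ⊕ y ≡ x′ ⊕ y → x ≡ x′)
  (fibre : ∀ y z → sum (λ v → ⟦ (lab v ⊕ y) Fin.≟ z ⟧) ≤ m)
  where

  colouring : EdgeColouring n r
  colouring = record { col = λ u v → lab u ⊕ lab v ; sym = λ u v → ⊕-comm (lab u) (lab v) }

  LabelsDistinct : Subset n → Set
  LabelsDistinct S = ∀ a b → a ∈ S → b ∈ S → lab a ≡ lab b → a ≡ b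

  labelsDistinct? : ∀ S → Dec (LabelsDistinct S)
  labelsDistinct? S = Finₚ.all? λ a → Finₚ.all? λ b →
    (a ∈? S) →-dec ((b ∈? S) →-dec ((lab a Fin.≟ lab b) →-dec (a Fin.≟ b)))

  -- Rainbow sets alone do not carry the induction: two vertices with equal labels form a rainbow
  -- pair that no third vertex extends, since its edges to both get the same colour.
  Good : ℕ → Subset n → Set
  Good k S = ∣ S ∣ ≡ k × LabelsDistinct S × Rainbow colouring S

  good? : ∀ k S → Dec (Good k S)
  good? k S = (∣ S ∣ ≟ k) ×-dec (labelsDistinct? S ×-dec rainbow? colouring S)

  Conflict : Fin n → Fin r × Fin r → Set
  Conflict v (y , z) = lab v ⊕ y ≡ z

  conflict? : ∀ v yz → Dec (Conflict v yz)
  conflict? v (y , z) = (lab v ⊕ y) Fin.≟ z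

  labels : Subset n → List (Fin r)
  labels S = map lab (elements S)

  -- By cancellation the pair (x, x ⊕ x) says that v repeats the label x. Writing this in the same
  -- form as a clash between a new edge and an old colour lets `fibre` bound both kinds.
  constraints : Subset n → List (Fin r × Fin r)
  constraints S = map (λ x → x , x ⊕ x) (labels S) ++ cartesianProduct (labels S) (pairs _⊕_ (labels S))

  length-constraints : ∀ S → length (constraints S) ≡ conflicts ∣ S ∣
  length-constraints S = begin
    length (constraints S)
      ≡⟨ length-++ (map (λ x → x , x ⊕ x) (labels S)) ⟩
    length (map (λ x → x , x ⊕ x) (labels S)) + length (cartesianProduct (labels S) (pairs _⊕_ (labels S)))
      ≡⟨ cong₂ _+_ (length-map _ (labels S)) (length-cartesianProduct (labels S) _) ⟩
    length (labels S) + length (labels S) * length (pairs _⊕_ (labels S))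
      ≡⟨ cong (λ x → length (labels S) + length (labels S) * x) (length-pairs _⊕_ (labels S)) ⟩
    length (labels S) + length (labels S) * triangle (length (labels S))
      ≡⟨ *-suc (length (labels S)) _ ⟨
    conflicts (length (labels S))
      ≡⟨ cong conflicts (trans (length-map lab (elements S)) (length-elements S)) ⟩
    conflicts ∣ S ∣ ∎
    where open ≡-Reasoning

  -- A union bound, with `fibre` applied to each constraint.
  conflicting-vertices : ∀ L → sum (λ v → ⟦ any? (conflict? v) L ⟧) ≤ m * length L
  conflicting-vertices [] = ≤-reflexive (trans (sum-const n 0) (trans (*-zeroʳ n) (sym (*-zeroʳ m))))
  conflicting-vertices (yz ∷ L) = begin
    sum (λ v → ⟦ any? (conflict? v) (yz ∷ L) ⟧)                                  ≤⟨ sum-mono union ⟩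
    sum (λ v → ⟦ conflict? v yz ⟧ + ⟦ any? (conflict? v) L ⟧)                    ≡⟨ ∑-distrib-+ (λ v → ⟦ conflict? v yz ⟧) _ ⟩
    sum (λ v → ⟦ conflict? v yz ⟧) + sum (λ v → ⟦ any? (conflict? v) L ⟧)        ≤⟨ +-mono-≤ (uncurry fibre yz) (conflicting-vertices L) ⟩
    m + m * length L                                                             ≡⟨ *-suc m (length L) ⟨
    m * suc (length L)                                                           ∎
    where
    open ≤-Reasoning
    union : ∀ v → ⟦ any? (conflict? v) (yz ∷ L) ⟧ ≤ ⟦ conflict? v yz ⟧ + ⟦ any? (conflict? v) L ⟧
    union v with conflict? v yz
    ... | yes _ = s≤s z≤n
    ... | no _  = ≤-refl

  module _ {k S v} (S-good : Good k S) (free : ¬ Any (Conflict v) (constraints S)) where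

    private
      distinct : LabelsDistinct S
      distinct = proj₁ (proj₂ S-good)
      rainbow : Rainbow colouring S
      rainbow = proj₂ (proj₂ S-good)

    new-label : ∀ {a} → a ∈ S → lab v ≢ lab a
    new-label {a} a∈S eq = free (lose (∈-++⁺ˡ (∈-map⁺ _ (∈-map⁺ lab (∈-elements a∈S)))) (cong (_⊕ lab a) eq))

    new-vertex : v ∉ S
    new-vertex v∈S = new-label v∈S refl

    new-colour : ∀ {a b c} → a ∈ S → b ∈ S → c ∈ S → b ≢ c → lab v ⊕ lab a ≢ lab b ⊕ lab c
    new-colour {a} {b} {c} a∈S b∈S c∈S b≢c eq =
      free (lose (∈-++⁺ʳ _ (∈-cartesianProduct⁺ (∈-labels a∈S)
        (∈-pairs _⊕_ ⊕-comm (∈-labels b∈S) (∈-labels c∈S) (b≢c ∘ distinct _ _ b∈S c∈S)))) eq)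
      where
      ∈-labels : ∀ {u} → u ∈ S → lab u ∈ˡ labels S
      ∈-labels u∈S = ∈-map⁺ lab (∈-elements u∈S)

    same-new-colour : ∀ {a b} → a ∈ S → b ∈ S → lab v ⊕ lab a ≡ lab v ⊕ lab b → a ≡ b
    same-new-colour {a} {b} a∈S b∈S eq = distinct _ _ a∈S b∈S (⊕-cancelʳ (lab v)
      (trans (⊕-comm (lab a) (lab v)) (trans eq (⊕-comm (lab v) (lab b)))))

    distinct-insert : LabelsDistinct (S [ v ]≔ inside)
    distinct-insert a b a∈ b∈ eq with ∈-insert⁻ S v a∈ | ∈-insert⁻ S v b∈
    ... | inj₁ refl | inj₁ refl = refl
    ... | inj₁ refl | inj₂ b∈S  = contradiction eq (new-label b∈S)
    ... | inj₂ a∈S  | inj₁ refl = contradiction (sym eq) (new-label a∈S)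
    ... | inj₂ a∈S  | inj₂ b∈S  = distinct a b a∈S b∈S eq

    -- `Rainbow` lists the ends of an edge in increasing order, so the new vertex may be either end;
    -- being strict, the order excludes v at both.
    data EdgeView : Fin n → Fin n → Set where
      old   : ∀ {a b} → a ∈ S → b ∈ S → EdgeView a b
      left  : ∀ {b} → b ∈ S → EdgeView v b
      right : ∀ {a} → a ∈ S → EdgeView a v

    edgeView : ∀ {a b} → a Fin.< b → a ∈ S [ v ]≔ inside → b ∈ S [ v ]≔ inside → EdgeView a b
    edgeView a<b a∈ b∈ with ∈-insert⁻ S v a∈ | ∈-insert⁻ S v b∈
    ... | inj₁ refl | inj₁ refl = contradiction refl (Finₚ.<⇒≢ a<b)
    ... | inj₁ refl | inj₂ b∈S  = left b∈S
    ... | inj₂ a∈S  | inj₁ refl = right a∈S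
    ... | inj₂ a∈S  | inj₂ b∈S  = old a∈S b∈S

    rainbow-insert : Rainbow colouring (S [ v ]≔ inside)
    rainbow-insert a b a′ b′ a<b a′<b′ a∈ b∈ a′∈ b′∈ eq
      with edgeView a<b a∈ b∈ | edgeView a′<b′ a′∈ b′∈
    ... | old a∈S b∈S | old a′∈S b′∈S = rainbow a b a′ b′ a<b a′<b′ a∈S b∈S a′∈S b′∈S eq
    ... | old a∈S b∈S | left b′∈S     = contradiction (sym eq) (new-colour b′∈S a∈S b∈S (Finₚ.<⇒≢ a<b))
    ... | old a∈S b∈S | right a′∈S    =
      contradiction (trans (⊕-comm _ _) (sym eq)) (new-colour a′∈S a∈S b∈S (Finₚ.<⇒≢ a<b))
    ... | left b∈S    | old a′∈S b′∈S = contradiction eq (new-colour b∈S a′∈S b′∈S (Finₚ.<⇒≢ a′<b′))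
    ... | right a∈S   | old a′∈S b′∈S =
      contradiction (trans (⊕-comm _ _) eq) (new-colour a∈S a′∈S b′∈S (Finₚ.<⇒≢ a′<b′))
    ... | left b∈S    | left b′∈S     = refl , same-new-colour b∈S b′∈S eq
    -- This case is void: equal colours identify the other ends, which would then lie both above and
    -- below v.
    ... | left b∈S    | right a′∈S    with refl ← same-new-colour b∈S a′∈S (trans eq (⊕-comm _ _)) =
      contradiction a<b (Finₚ.<-asym a′<b′)
    ... | right a∈S   | left b′∈S     with refl ← same-new-colour a∈S b′∈S (trans (⊕-comm _ _) eq) =
      contradiction a<b (Finₚ.<-asym a′<b′)
    ... | right a∈S   | right a′∈S    =
      same-new-colour a∈S a′∈S (trans (⊕-comm _ _) (trans eq (⊕-comm _ _))) , refl

    good-insert : Good (suc k) (S [ v ]≔ inside)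
    good-insert = trans (∣insert∣ S v new-vertex) (cong suc (proj₁ S-good)) , distinct-insert , rainbow-insert

  -- A vertex either is free of constraints and extends S, or satisfies one of them. Vertices of S
  -- are of the second sort, through their own label.
  extensions : ∀ {k S} → Good k S →
    n ≤ sum (λ v → ⟦ ¬? (v ∈? S) ⟧ * ⟦ good? (suc k) (S [ v ]≔ inside) ⟧) + m * conflicts k
  extensions {k} {S} S-good@(refl , _) = begin
    n                                                                  ≡⟨ *-identityʳ n ⟨
    n * 1                                                              ≡⟨ sum-const n 1 ⟨
    sum {n} (λ _ → 1)                                                  ≤⟨ sum-mono extension-or-conflict ⟩
    sum (λ v → ext v + ⟦ any? (conflict? v) (constraints S) ⟧)         ≡⟨ ∑-distrib-+ ext _ ⟩
    sum ext + sum (λ v → ⟦ any? (conflict? v) (constraints S) ⟧)       ≤⟨ +-monoʳ-≤ (sum ext) (conflicting-vertices (constraints S)) ⟩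
    sum ext + m * length (constraints S)                               ≡⟨ cong (λ x → sum ext + m * x) (length-constraints S) ⟩
    sum ext + m * conflicts ∣ S ∣                                      ∎
    where
    open ≤-Reasoning
    ext : Fin n → ℕ
    ext v = ⟦ ¬? (v ∈? S) ⟧ * ⟦ good? (suc ∣ S ∣) (S [ v ]≔ inside) ⟧
    extension-or-conflict : ∀ v → 1 ≤ ext v + ⟦ any? (conflict? v) (constraints S) ⟧
    extension-or-conflict v with any? (conflict? v) (constraints S)
    ... | yes _   = m≤n+m 1 (ext v)
    ... | no free
      rewrite ⟦⟧-true (¬? (v ∈? S)) (new-vertex S-good free)
            | ⟦⟧-true (good? (suc ∣ S ∣) (S [ v ]≔ inside)) (good-insert S-good free) = ≤-refl

  goodCount : ℕ → ℕ
  goodCount k = ∑⊆ n (λ S → ⟦ good? k S ⟧)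

  -- Double counting of one-vertex extensions: from below by `extensions` for each good k-set, from
  -- above because a set of size k + 1 arises by deleting one of its k + 1 vertices.
  goodCount-step : ∀ k → (n ∸ m * conflicts k) * goodCount k ≤ suc k * goodCount (suc k)
  goodCount-step k = begin
    (n ∸ m * conflicts k) * goodCount k                               ≡⟨ ∑⊆-*ˡ n (n ∸ m * conflicts k) _ ⟨
    ∑⊆ n (λ S → (n ∸ m * conflicts k) * ⟦ good? k S ⟧)                ≤⟨ ∑⊆-mono n extend ⟩
    ∑⊆ n (λ S → sum (λ v → ⟦ ¬? (v ∈? S) ⟧ * ⟦ good? (suc k) (S [ v ]≔ inside) ⟧))
                                                                      ≡⟨ ∑-insert n (λ S → ⟦ good? (suc k) S ⟧) ⟩
    ∑⊆ n (λ S → ∣ S ∣ * ⟦ good? (suc k) S ⟧)                          ≤⟨ ∑⊆-mono n size ⟩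
    ∑⊆ n (λ S → suc k * ⟦ good? (suc k) S ⟧)                          ≡⟨ ∑⊆-*ˡ n (suc k) _ ⟩
    suc k * goodCount (suc k)                                         ∎
    where
    open ≤-Reasoning
    extend : ∀ S → (n ∸ m * conflicts k) * ⟦ good? k S ⟧ ≤
                   sum (λ v → ⟦ ¬? (v ∈? S) ⟧ * ⟦ good? (suc k) (S [ v ]≔ inside) ⟧)
    extend S = helper (good? k S)
      where
      helper : (d : Dec (Good k S)) → (n ∸ m * conflicts k) * ⟦ d ⟧ ≤
               sum (λ v → ⟦ ¬? (v ∈? S) ⟧ * ⟦ good? (suc k) (S [ v ]≔ inside) ⟧)
      helper (no _)  = ≤-trans (≤-reflexive (*-zeroʳ (n ∸ m * conflicts k))) z≤n
      helper (yes g) = ≤-trans (≤-reflexive (*-identityʳ _))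
        (m≤n+o⇒m∸n≤o _ _ (≤-trans (extensions g) (≤-reflexive (+-comm _ (m * conflicts k)))))
    size : ∀ S → ∣ S ∣ * ⟦ good? (suc k) S ⟧ ≤ suc k * ⟦ good? (suc k) S ⟧
    size S = helper (good? (suc k) S)
      where
      helper : (d : Dec (Good (suc k) S)) → ∣ S ∣ * ⟦ d ⟧ ≤ suc k * ⟦ d ⟧
      helper (no _)         = ≤-reflexive (trans (*-zeroʳ ∣ S ∣) (sym (*-zeroʳ (suc k))))
      helper (yes (eq , _)) = ≤-reflexive (cong (_* 1) eq)

  goodCount-zero : 1 ≤ goodCount 0
  goodCount-zero = ≤-trans (empty n) (∑⊆-mono n λ S → ⟦⟧-mono (∣ S ∣ ≟ 0) (good? 0 S) (empty-good S))
    where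
    empty : ∀ n → 1 ≤ ∑⊆ n (λ S → ⟦ ∣ S ∣ ≟ 0 ⟧)
    empty zero    = ≤-refl
    empty (suc n) = ≤-trans (empty n) (m≤n+m _ _)
    ∉-empty : ∀ {n} (S : Subset n) → ∣ S ∣ ≡ 0 → ∀ {v} → v ∉ S
    ∉-empty (outside ∷ S) eq (there v∈S) = ∉-empty S eq v∈S
    empty-good : ∀ S → ∣ S ∣ ≡ 0 → Good 0 S
    empty-good S eq = eq , (λ a b a∈S → contradiction a∈S (∉-empty S eq)) ,
      λ a b a′ b′ a<b a′<b′ a∈S → contradiction a∈S (∉-empty S eq)

  goodCount≤rainbowCopies : ∀ k → goodCount k ≤ rainbowCopies k colouring
  goodCount≤rainbowCopies k = begin
    goodCount k                                    ≤⟨ ∑⊆-mono n (λ S → ⟦⟧-mono (good? k S) (rainbowKt? S) (λ (s , _ , rb) → s , rb)) ⟩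
    ∑⊆ n (λ S → ⟦ rainbowKt? S ⟧)                  ≡⟨ length-filter-allSubsets n rainbowKt? ⟨
    rainbowCopies k colouring                      ∎
    where
    open ≤-Reasoning
    rainbowKt? : ∀ S → Dec (IsRainbowKt k colouring S)
    rainbowKt? S = (∣ S ∣ ≟ k) ×-dec rainbow? colouring S

  module _ (n≡m*r : n ≡ m * r) where

    -- Since n = m * r, the factor n - m * `conflicts k` of `goodCount-step` is m * (r -
    -- `conflicts k`). Relative to n this is (r - `conflicts k`) / r, while C(n,k+1) is at most n /
    -- (k+1) times C(n,k).
    goodCount-lower : ∀ k → (n C k) * ∏< k (λ i → r ∸ conflicts i) ≤ goodCount k * r ^ k
    goodCount-lower zero    = ≤-trans goodCount-zero (≤-reflexive (sym (*-identityʳ _)))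
    goodCount-lower (suc k) = *-cancelˡ-≤ (suc k) (begin
      suc k * ((n C suc k) * (p * q))              ≡⟨ regroup₁ (suc k) (n C suc k) p q ⟩
      (suc k * (n C suc k)) * (p * q)              ≤⟨ *-monoˡ-≤ (p * q) ([1+k]*nC[1+k]≤n*nCk n k) ⟩
      n * (n C k) * (p * q)                        ≡⟨ regroup₂ n (n C k) p q ⟩
      (n C k) * p * (n * q)                        ≤⟨ *-monoˡ-≤ (n * q) (goodCount-lower k) ⟩
      goodCount k * r ^ k * (n * q)                ≡⟨ cong (λ x → goodCount k * r ^ k * (x * q)) n≡m*r ⟩
      goodCount k * r ^ k * (m * r * q)            ≡⟨ regroup₃ (goodCount k) (r ^ k) m r q ⟩
      m * q * goodCount k * (r * r ^ k)            ≡⟨ cong (λ x → x * goodCount k * (r * r ^ k)) m*q≡ ⟩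
      (n ∸ m * conflicts k) * goodCount k * (r * r ^ k)
                                                   ≤⟨ *-monoˡ-≤ (r * r ^ k) (goodCount-step k) ⟩
      suc k * goodCount (suc k) * (r * r ^ k)      ≡⟨ *-assoc (suc k) (goodCount (suc k)) (r * r ^ k) ⟩
      suc k * (goodCount (suc k) * (r * r ^ k))    ∎)
      where
      open ≤-Reasoning
      p = ∏< k (λ i → r ∸ conflicts i)
      q = r ∸ conflicts k
      m*q≡ : m * q ≡ n ∸ m * conflicts k
      m*q≡ = trans (*-distribˡ-∸ m r (conflicts k)) (cong (_∸ m * conflicts k) (sym n≡m*r))
      regroup₁ : ∀ s c p q → s * (c * (p * q)) ≡ s * c * (p * q)
      regroup₁ = solve-∀
      regroup₂ : ∀ n c p q → n * c * (p * q) ≡ c * p * (n * q)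
      regroup₂ = solve-∀
      regroup₃ : ∀ g x m r q → g * x * (m * r * q) ≡ m * q * g * (r * x)
      regroup₃ = solve-∀

-- The colouring by residues modulo r

module _ {r : ℕ} .{{_ : NonZero r}} where

  infixl 6 _⊕_ _⊖_

  _⊕_ : Fin r → Fin r → Fin r
  x ⊕ y = (toℕ x + toℕ y) mod r

  -- The inverse of y is represented by y * (r - 1): adding y gives the multiple y * r, and no
  -- truncated subtraction of residues is involved.
  _⊖_ : Fin r → Fin r → Fin r
  x ⊖ y = (toℕ x + toℕ y * pred r) mod r

  toℕ-mod : ∀ a → toℕ (a mod r) ≡ a % r
  toℕ-mod a = Finₚ.toℕ-fromℕ< (m%n<n a r)

  toℕ%r : ∀ (x : Fin r) → toℕ x % r ≡ toℕ x
  toℕ%r x = m<n⇒m%n≡m (Finₚ.toℕ<n x)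

  ⊕-comm : ∀ x y → x ⊕ y ≡ y ⊕ x
  ⊕-comm x y = cong (_mod r) (+-comm (toℕ x) (toℕ y))

  x⊕y⊖y≡x : ∀ x y → (x ⊕ y) ⊖ y ≡ x
  x⊕y⊖y≡x x y = Finₚ.toℕ-injective (begin
    toℕ (x ⊕ y ⊖ y)                           ≡⟨ toℕ-mod _ ⟩
    (toℕ (x ⊕ y) + w) % r                     ≡⟨ cong (λ a → (a + w) % r) (toℕ-mod _) ⟩
    ((toℕ x + toℕ y) % r + w) % r             ≡⟨ %-distribˡ-+ _ w r ⟩
    ((toℕ x + toℕ y) % r % r + w % r) % r     ≡⟨ cong (λ a → (a + w % r) % r) (m%n%n≡m%n (toℕ x + toℕ y) r) ⟩
    ((toℕ x + toℕ y) % r + w % r) % r         ≡⟨ %-distribˡ-+ (toℕ x + toℕ y) w r ⟨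
    (toℕ x + toℕ y + w) % r                   ≡⟨ cong (_% r) (+-assoc (toℕ x) (toℕ y) w) ⟩
    (toℕ x + (toℕ y + w)) % r                 ≡⟨ cong (λ a → (toℕ x + a) % r) (trans (sym (*-suc (toℕ y) (pred r))) (cong (toℕ y *_) (suc-pred r))) ⟩
    (toℕ x + toℕ y * r) % r                   ≡⟨ [m+kn]%n≡m%n (toℕ x) (toℕ y) r ⟩
    toℕ x % r                                 ≡⟨ toℕ%r x ⟩
    toℕ x                                     ∎)
    where
    open ≡-Reasoning
    w = toℕ y * pred r

  ⊕-cancelʳ : ∀ {x x′} y → x ⊕ y ≡ x′ ⊕ y → x ≡ x′
  ⊕-cancelʳ {x} {x′} y eq = trans (sym (x⊕y⊖y≡x x y)) (trans (cong (_⊖ y) eq) (x⊕y⊖y≡x x′ y))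

  module _ (m : ℕ) where

    -- The vertices form m blocks of r, and each block carries every label once. With cancellation,
    -- a constraint therefore excludes at most one vertex per block.
    label : Fin (m * r) → Fin r
    label = remainder {m} r

    label-combine : ∀ (i : Fin m) j → label (combine i j) ≡ j
    label-combine i j = cong proj₂ (Finₚ.remQuot-combine i j)

    label-fibre : ∀ y z → sum (λ v → ⟦ (label v ⊕ y) Fin.≟ z ⟧) ≤ m
    label-fibre y z = begin
      sum (λ v → ⟦ (label v ⊕ y) Fin.≟ z ⟧)                                       ≡⟨ sum-combine m _ ⟩
      sum (λ i → sum (λ j → ⟦ (label (combine {m} i j) ⊕ y) Fin.≟ z ⟧))           ≤⟨ sum-mono block ⟩
      sum {m} (λ _ → 1)                                                           ≡⟨ sum-const m 1 ⟩
      m * 1                                                                       ≡⟨ *-identityʳ m ⟩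
      m                                                                           ∎
      where
      open ≤-Reasoning
      block : ∀ i → sum (λ j → ⟦ (label (combine {m} i j) ⊕ y) Fin.≟ z ⟧) ≤ 1
      block i = sum-⟦⟧≤1 (λ j → (label (combine {m} i j) ⊕ y) Fin.≟ z) λ {j} {j′} p q →
        trans (sym (label-combine i j)) (trans (⊕-cancelʳ y (trans p (sym q))) (label-combine i j′))

    open SumColouring {m = m} label _⊕_ ⊕-comm ⊕-cancelʳ label-fibre public
      using (colouring; goodCount; goodCount-lower; goodCount≤rainbowCopies)

    -- Colour k appears between label 0 in the first block and label k in the second. Taking two
    -- blocks keeps the vertices distinct even for k = 0.
    colouring-surjective : 2 ≤ m → Surjective colouring
    colouring-surjective (s≤s (s≤s _)) k =
      combine (zero {m ∸ 1}) 0r , combine (suc (zero {m ∸ 2})) k , distinct , (begin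
        label (combine (zero {m ∸ 1}) 0r) ⊕ label (combine (suc (zero {m ∸ 2})) k)
          ≡⟨ cong₂ _⊕_ (label-combine zero 0r) (label-combine (suc zero) k) ⟩
        0r ⊕ k                       ≡⟨ Finₚ.toℕ-injective (trans (toℕ-mod _) (trans (cong (λ a → (a + toℕ k) % r) (Finₚ.toℕ-fromℕ< _)) (toℕ%r k))) ⟩
        k                            ∎)
      where
      open ≡-Reasoning
      0r : Fin r
      0r = fromℕ< (>-nonZero⁻¹ r)
      distinct : combine (zero {m ∸ 1}) 0r ≢ combine (suc (zero {m ∸ 2})) k
      distinct eq with () ← Finₚ.combine-injectiveˡ (zero {m ∸ 1}) 0r (suc zero) k eq

    rainbowCopies-lower : ∀ k →
      ((m * r) C k) * ∏< k (λ i → r ∸ conflicts i) ≤ rainbowCopies k colouring * r ^ k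
    rainbowCopies-lower k = ≤-trans (goodCount-lower refl k) (*-monoˡ-≤ (r ^ k) (goodCount≤rainbowCopies k))

-- Comparison with the limit

-- Induction on the distance from `f a` to the bound: a larger value would shorten the distance, and
-- at distance zero `f a` is the bound itself.
¬¬-maximum : ∀ {A : Set} (P : A → Set) (f : A → ℕ) bound → (∀ a → f a ≤ bound) →
             ∀ a → P a → ¬ ¬ ∃ λ a → P a × (∀ b → P b → f b ≤ f a)
¬¬-maximum {A} P f bound f≤bound a Pa no-max = climb bound a Pa (m∸n≤m bound (f a))
  where
  climb : ∀ gap a → P a → ¬ (bound ∸ f a ≤ gap)
  climb gap a Pa gap-bound = no-max (a , Pa , maximal gap gap-bound)
    where
    maximal : ∀ gap → bound ∸ f a ≤ gap → ∀ b → P b → f b ≤ f a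
    maximal gap gap-bound b Pb with f b ≤? f a
    ... | yes fb≤fa = fb≤fa
    ... | no fb≰fa with gap
    ...   | zero    = ≤-trans (f≤bound b) (m∸n≡0⇒m≤n (n≤0⇒n≡0 gap-bound))
    ...   | suc gap = contradiction
      (s≤s⁻¹ (≤-trans (∸-monoʳ-< (≰⇒> fb≰fa) (f≤bound b)) gap-bound)) (climb gap b Pb)

rainbowCopies≤ : ∀ t {n r} (c : EdgeColouring n r) → rainbowCopies t c ≤ length (allSubsets n)
rainbowCopies≤ t {n} c = length-filter (λ S → (∣ S ∣ ≟ t) ×-dec rainbow? c S) (allSubsets n)

-- The maximum over all colourings is not computed: RainbowUncommon is a negation, so it may
-- be assumed to exist.
max-exists : ∀ {t n r} (c : EdgeColouring n r) → Surjective c → ¬ ¬ ∃ (IsMaxRainbow t n r)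
max-exists {t} {n} c c-surj no-max =
  ¬¬-maximum Surjective (rainbowCopies t) (length (allSubsets n)) (rainbowCopies≤ t) c c-surj
    λ (c , c-surj , maximal) → no-max (rainbowCopies t c , (c , c-surj , refl) , maximal)

÷-≃ : ∀ a d → ℚ.toℚᵘ (a ÷ suc d) ℚᵘ.≃ mkℚᵘ (ℤ.+ a) d
÷-≃ a d = ℚₚ.toℚᵘ-fromℚᵘ (mkℚᵘ (ℤ.+ a) d)

-- Cross-multiplication, carried out on unnormalised fractions. Positive denominators keep clear of
-- the default value 0 of `_÷_`.
÷-mono-≤ : ∀ {a b d e} → 0 < d → 0 < e → a * e ≤ b * d → a ÷ d ℚ.≤ b ÷ e
÷-mono-≤ {a} {b} {suc d} {suc e} _ _ le = ℚₚ.toℚᵘ-cancel-≤ (begin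
  ℚ.toℚᵘ (a ÷ suc d)   ≃⟨ ÷-≃ a d ⟩
  mkℚᵘ (ℤ.+ a) d       ≤⟨ ℚᵘ.*≤* (subst₂ ℤ._≤_ (ℤₚ.pos-* a (suc e)) (ℤₚ.pos-* b (suc d)) (ℤ.+≤+ le)) ⟩
  mkℚᵘ (ℤ.+ b) e       ≃⟨ ÷-≃ b e ⟨
  ℚ.toℚᵘ (b ÷ suc e)   ∎)
  where open ℚᵘₚ.≤-Reasoning

÷-mono-< : ∀ {a b d e} → 0 < d → 0 < e → a * e < b * d → a ÷ d ℚ.< b ÷ e
÷-mono-< {a} {b} {suc d} {suc e} _ _ lt = ℚₚ.toℚᵘ-cancel-< (begin-strict
  ℚ.toℚᵘ (a ÷ suc d)   ≃⟨ ÷-≃ a d ⟩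
  mkℚᵘ (ℤ.+ a) d       <⟨ ℚᵘ.*<* (subst₂ ℤ._<_ (ℤₚ.pos-* a (suc e)) (ℤₚ.pos-* b (suc d)) (ℤ.+<+ lt)) ⟩
  mkℚᵘ (ℤ.+ b) e       ≃⟨ ÷-≃ b e ⟨
  ℚ.toℚᵘ (b ÷ suc e)   ∎)
  where open ℚᵘₚ.≤-Reasoning

p<q⇒0<q-p : ∀ {p q} → p ℚ.< q → 0ℚ ℚ.< q ℚ.- p
p<q⇒0<q-p {p} {q} p<q = subst (ℚ._< q ℚ.- p) (ℚₚ.+-inverseʳ p) (ℚₚ.+-monoˡ-< (ℚ.- p) p<q)

p≤∣p∣ : ∀ p → p ℚ.≤ ℚ.∣ p ∣
p≤∣p∣ p with ℚₚ.≤-total 0ℚ p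
... | inj₁ 0≤p = ℚₚ.≤-reflexive (sym (ℚₚ.0≤p⇒∣p∣≡p 0≤p))
... | inj₂ p≤0 = ℚₚ.≤-trans p≤0 (ℚₚ.0≤∣p∣ p)

commonValue< : ∀ {t r} .{{_ : NonZero r}} →
  ∏< (triangle t) (r ∸_) * r ^ t < ∏< t (λ i → r ∸ conflicts i) * r ^ triangle t →
  commonValue t r ℚ.< ∏< t (λ i → r ∸ conflicts i) ÷ (r ^ t)
commonValue< {t} {r} lt rewrite sym (triangle≡C2 t) | nCk*k!≡∏ r (triangle t) =
  ÷-mono-< (m^n>0 r (triangle t)) (m^n>0 r t) lt

-- The residue colouring competes for the maximum; t ≤ m * r makes the number of copies of K_t
-- positive.
density≤maximum : ∀ t r m .{{_ : NonZero r}} → 2 ≤ m → t ≤ m * r → ∀ M → IsMaxRainbow t (m * r) r M →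
  ∏< t (λ i → r ∸ conflicts i) ÷ (r ^ t) ℚ.≤ M ÷ ((m * r) C t)
density≤maximum t r m 2≤m t≤m*r M (_ , maximal) = ÷-mono-≤ (m^n>0 r t) (nCk>0 t≤m*r) (begin
  ∏< t (λ i → r ∸ conflicts i) * ((m * r) C t)    ≡⟨ *-comm _ ((m * r) C t) ⟩
  ((m * r) C t) * ∏< t (λ i → r ∸ conflicts i)    ≤⟨ rainbowCopies-lower m t ⟩
  rainbowCopies t (colouring m) * r ^ t           ≤⟨ *-monoˡ-≤ (r ^ t) (maximal (colouring m) (colouring-surjective m 2≤m)) ⟩
  M * r ^ t                                       ∎)
  where open ≤-Reasoning

-- The lower bound on the maximal density is the same for every n = m * r with m large, and it
-- exceeds `commonValue t r`. Taking ε to be this gap contradicts convergence.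
uncommon : ∀ {t r} .{{_ : NonZero r}} →
  ∏< (triangle t) (r ∸_) * r ^ t < ∏< t (λ i → r ∸ conflicts i) * r ^ triangle t → RainbowUncommon t r
uncommon {t} {r} lt converges = beyond limit
  where
  density = ∏< t (λ i → r ∸ conflicts i) ÷ (r ^ t)
  limit : ∃ λ N → ∀ n → N ≤ n → ∀ M → IsMaxRainbow t n r M →
    ℚ.∣ (M ÷ (n C t)) ℚ.- commonValue t r ∣ ℚ.< density ℚ.- commonValue t r
  limit = converges (density ℚ.- commonValue t r) (p<q⇒0<q-p (commonValue< {t} lt))
  beyond : ¬ ∃ λ N → ∀ n → N ≤ n → ∀ M → IsMaxRainbow t n r M →
    ℚ.∣ (M ÷ (n C t)) ℚ.- commonValue t r ∣ ℚ.< density ℚ.- commonValue t r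
  beyond (N , close) = max-exists {t} (colouring m) (colouring-surjective m 2≤m) λ (M , isMax) →
    ℚₚ.<-irrefl refl (ℚₚ.≤-<-trans
      (ℚₚ.≤-trans (ℚₚ.+-monoˡ-≤ (ℚ.- commonValue t r) (density≤maximum t r m 2≤m (≤-trans (m≤n+m t N) N+t≤m*r) M isMax))
                  (p≤∣p∣ _))
      (close (m * r) (≤-trans (m≤m+n N t) N+t≤m*r) M isMax))
    where
    -- The 2 serves surjectivity, N brings m * r into the range of the limit, and t makes K_t fit
    -- into the graph.
    m = 2 + (N + t)
    2≤m : 2 ≤ m
    2≤m = s≤s (s≤s z≤n)
    N+t≤m*r : N + t ≤ m * r
    N+t≤m*r = ≤-trans (m≤n+m (N + t) 2) (m≤m*n m r)

theorem3 : ∀ (t : ℕ) → 6 ≤ t → ∃ λ (rₜ : ℕ) → ∀ (r : ℕ) → rₜ ≤ r → RainbowUncommon t r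
-- The threshold is E * F + 1 with E = C(e,2) and F the sum of the conflict counts, so `large` is
-- literally E * F < r, which also makes r nonzero.
theorem3 t 6≤t = suc (triangle (triangle t) * ∑< t conflicts) , λ r large →
  uncommon {t} {{>-nonZero (≤-<-trans z≤n large)}} (∏-gap r (triangle t) t conflicts (∑conflicts<∑i 6≤t) large)
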